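{- Let $\mathcal S=(\mathcal P,\mathcal L)$ be a linear space with $v$ points and constant line size $k$, $2<k<v$, let $G\le\mathrm{Aut}(\mathcal S)$ be transitive on lines, and let $\mathfrak C$ be a non-trivial $G$-invariant partition of $\mathcal P$ with $d$ classes of size $c$. Then (i) $|\mathrm{spec}\,\mathcal S|\ge 2$; (ii) $c\notin\mathrm{spec}\,\mathcal S$; (iii) if $\mathrm{spec}\,\mathcal S=\{1,h\}$ with $h\ge 2$, then for each class $C\in\mathfrak C$ the induced linear space $\mathcal S|_C$ has constant line size $h$.
   Context: A linear space $\mathcal S=(\mathcal P,\mathcal L)$: a finite set $\mathcal P$ of points and a set $\mathcal L$ of subsets (lines) such that any two distinct points lie on exactly one line and each line has at least two points. Line-transitivity of $G$ implies point-transitivity. A partition is non-trivial if it has more than one class and its classes have more than one element; $G$-invariant means $G$ permutes the classes. For a line $\lambda$ and $i\ge0$, let $d_i$ be the number of classes $C\in\mathfrak C$ with $|C\cap\lambda|=i$ (independent of $\lambda$ by line-transitivity); $\mathrm{spec}\,\mathcal S=\{i>0: d_i\ne0\}$. For $F\subseteq\mathcal P$ with $|F|\ge2$, the induced linear space is $\mathcal S|_F=(F,\{\lambda\cap F:\lambda\in\mathcal L,\ |\lambda\cap F|\ge2\})$. -}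

module Defs where

open import Data.Bool using () renaming (_≟_ to _≟ᵇ_)
open import Data.Fin using (Fin)
open import Data.Fin.Permutation
  using (Permutation′; _⟨$⟩ˡ_; _≈_; _∘ₚ_; flip; id)
open import Data.Fin.Subset using (Subset; _∈_; _⊆_; _∩_; _-_; ⊤; ∣_∣; Nonempty)
open import Data.Fin.Subset.Properties
  using (x∈p⇒∣p-x∣<∣p∣; x∈p∧x≢y⇒x∈p-y; p∩q⊆p; p∩q⊆q; x∈p∩q⁺; ∈⊤)
open import Data.List using (List; length; filter; map; upTo; deduplicate)
open import Data.List.Membership.Propositional using () renaming (_∈_ to _∈ₗ_)
open import Data.List.Membership.Propositional.Properties
  using (∈-map⁺; ∈-map⁻; ∈-filter⁺; ∈-filter⁻; ∈-deduplicate⁺; ∈-deduplicate⁻)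
open import Data.List.Relation.Unary.Unique.Propositional using (Unique)
import Data.List.Relation.Unary.Unique.DecPropositional.Properties as Dedup
open import Data.Nat using (ℕ; suc; z≤n; s≤s; _≤_; _<_; _≤?_; _<?_; _≟_)
open import Data.Nat.Properties using (≤-trans; ≤-<-trans)
open import Data.Product using (∃; ∃!; _×_; _,_; proj₁; proj₂)
open import Data.Vec using (lookup; tabulate)
open import Data.Vec.Properties using (≡-dec)
open import Function using (_⇔_; _∘_)
open import Level using (0ℓ)
open import Relation.Binary using (DecidableEquality)
open import Relation.Binary.PropositionalEquality
  using (_≡_; _≢_; refl; sym; cong)
open import Relation.Nullary.Decidable using (¬?; _×-dec_)
open import Relation.Unary using (Pred)

private
  variable
    n v : ℕ
    P : Subset n

-- A finite set of subsets is represented by a duplicate-free list; the order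
-- of the list plays no role.

-- The point set P is a subset of an ambient Fin n, so that a space induced on
-- a set of points is again a linear space.  A linear space with v points is,
-- up to naming the points, one whose point set is all of Fin v.
record LinearSpace {n : ℕ} (P : Subset n) : Set where
  field
    lines        : List (Subset n)
    lines-unique : Unique lines
    lines⊆P      : ∀ {ℓ} → ℓ ∈ₗ lines → ℓ ⊆ P
    2≤∣line∣     : ∀ {ℓ} → ℓ ∈ₗ lines → 2 ≤ ∣ ℓ ∣
    join         : ∀ {x y} → x ∈ P → y ∈ P → x ≢ y →
                   ∃! _≡_ λ ℓ → ℓ ∈ₗ lines × x ∈ ℓ × y ∈ ℓ

open LinearSpace public

ConstantLineSize : LinearSpace P → ℕ → Set
ConstantLineSize S k = ∀ {ℓ} → ℓ ∈ₗ lines S → ∣ ℓ ∣ ≡ k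

_≟ˢ_ : DecidableEquality (Subset n)
_≟ˢ_ = ≡-dec _≟ᵇ_

inducedLines : LinearSpace (⊤ {n}) → Subset n → List (Subset n)
inducedLines S F =
  deduplicate _≟ˢ_ (filter (λ μ → 2 ≤? ∣ μ ∣) (map (_∩ F) (lines S)))

private
  two-elements : ∀ {A : Subset n} {x y} → x ∈ A → y ∈ A → x ≢ y → 2 ≤ ∣ A ∣
  two-elements {A = A} {x} {y} x∈A y∈A x≢y =
    ≤-trans (s≤s (≤-<-trans z≤n (x∈p⇒∣p-x∣<∣p∣ y∈A-x))) (x∈p⇒∣p-x∣<∣p∣ x∈A)
    where
    y∈A-x : y ∈ A - x
    y∈A-x = x∈p∧x≢y⇒x∈p-y y∈A (x≢y ∘ sym)

  inducedLines⁻ : ∀ (S : LinearSpace (⊤ {n})) F {μ} → μ ∈ₗ inducedLines S F →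
                  (∃ λ ℓ → ℓ ∈ₗ lines S × μ ≡ ℓ ∩ F) × 2 ≤ ∣ μ ∣
  inducedLines⁻ S F μ∈
    with μ∈map , 2≤∣μ∣ ← ∈-filter⁻ (λ μ → 2 ≤? ∣ μ ∣) {xs = map (_∩ F) (lines S)}
                          (∈-deduplicate⁻ _≟ˢ_ _ μ∈)
    = ∈-map⁻ (_∩ F) μ∈map , 2≤∣μ∣

  inducedLines⁺ : ∀ (S : LinearSpace (⊤ {n})) F {ℓ} → ℓ ∈ₗ lines S →
                  2 ≤ ∣ ℓ ∩ F ∣ → (ℓ ∩ F) ∈ₗ inducedLines S F
  inducedLines⁺ S F ℓ∈ 2≤ =
    ∈-deduplicate⁺ _≟ˢ_
      (∈-filter⁺ (λ μ → 2 ≤? ∣ μ ∣) (∈-map⁺ (_∩ F) ℓ∈) 2≤)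

-- The construction makes sense for every F; it has lines only when 2 ≤ ∣ F ∣.
induced : LinearSpace (⊤ {n}) → (F : Subset n) → LinearSpace F
induced S F .lines        = inducedLines S F
induced S F .lines-unique = Dedup.deduplicate-! _≟ˢ_ _
induced S F .lines⊆P μ∈ x∈μ with (ℓ , _ , refl) , _ ← inducedLines⁻ S F μ∈ =
  p∩q⊆q ℓ F x∈μ
induced S F .2≤∣line∣ μ∈ = proj₂ (inducedLines⁻ S F μ∈)
induced S F .join {x} {y} x∈F y∈F x≢y
  with ℓ , (ℓ∈ , x∈ℓ , y∈ℓ) , unique ← S .join {x} {y} ∈⊤ ∈⊤ x≢y
  = ℓ ∩ F
  , (inducedLines⁺ S F ℓ∈ (two-elements x∈ y∈ x≢y) , x∈ , y∈)
  , unique′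
  where
  x∈ = x∈p∩q⁺ (x∈ℓ , x∈F)
  y∈ = x∈p∩q⁺ (y∈ℓ , y∈F)
  unique′ : ∀ {μ} → μ ∈ₗ inducedLines S F × x ∈ μ × y ∈ μ → ℓ ∩ F ≡ μ
  unique′ (μ∈ , x∈μ , y∈μ)
    with (ℓ′ , ℓ′∈ , refl) , _ ← inducedLines⁻ S F μ∈ =
    cong (_∩ F) (unique (ℓ′∈ , p∩q⊆p ℓ′ F x∈μ , p∩q⊆p ℓ′ F y∈μ))

-- y lies in the image of A under g exactly when g⁻¹ y lies in A.
image : Permutation′ n → Subset n → Subset n
image g A = tabulate λ y → lookup A (g ⟨$⟩ˡ y)

IsAutomorphism : LinearSpace (⊤ {v}) → Permutation′ v → Set
IsAutomorphism S g = ∀ ℓ → ℓ ∈ₗ lines S ⇔ image g ℓ ∈ₗ lines S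

record AutSubgroup {v : ℕ} (S : LinearSpace (⊤ {v})) : Set₁ where
  field
    member    : Pred (Permutation′ v) 0ℓ
    member-≈  : ∀ {g h} → g ≈ h → member g → member h
    member-id : member id
    member-∘  : ∀ {g h} → member g → member h → member (g ∘ₚ h)
    member-⁻¹ : ∀ {g} → member g → member (flip g)
    member⇒aut : ∀ {g} → member g → IsAutomorphism S g

open AutSubgroup public

LineTransitive : {S : LinearSpace (⊤ {v})} → AutSubgroup S → Set
LineTransitive {S = S} G =
  ∀ {ℓ m} → ℓ ∈ₗ lines S → m ∈ₗ lines S → ∃ λ g → member G g × image g ℓ ≡ m

record Partition (v : ℕ) : Set where
  field
    classes          : List (Subset v)
    classes-unique   : Unique classes
    classes-nonempty : ∀ {C} → C ∈ₗ classes → Nonempty C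
    classOf          : ∀ x → ∃! _≡_ λ C → C ∈ₗ classes × x ∈ C

open Partition public

NonTrivial : Partition v → Set
NonTrivial 𝔠 = 1 < length (classes 𝔠) × (∀ {C} → C ∈ₗ classes 𝔠 → 1 < ∣ C ∣)

Invariant : {S : LinearSpace (⊤ {v})} → AutSubgroup S → Partition v → Set
Invariant G 𝔠 =
  ∀ {g} → member G g → ∀ {C} → C ∈ₗ classes 𝔠 → image g C ∈ₗ classes 𝔠

-- The number dᵢ of classes meeting the line ℓ in exactly i points.
classesMeeting : Partition v → Subset v → ℕ → ℕ
classesMeeting 𝔠 ℓ i = length (filter (λ C → ∣ C ∩ ℓ ∣ ≟ i) (classes 𝔠))

-- The set of i > 0 with dᵢ ≠ 0, read off from the line ℓ and listed without
-- repetition; if a line-transitive group leaves the partition invariant, every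
-- line gives the same set.  Stopping at v loses nothing, since ∣ C ∩ ℓ ∣ ≤ v for
-- every class C.
spec : Partition v → Subset v → List ℕ
spec {v} 𝔠 ℓ =
  filter (λ i → (0 <? i) ×-dec ¬? (classesMeeting 𝔠 ℓ i ≟ 0)) (upTo (suc v))

{-# OPTIONS --safe #-}

-- Every point lies on r lines with r * (k - 1) = v - 1, and k ≤ r because a
-- point off a line is joined to each of its k points by a different line.
-- (i) If all non-empty intersections of lines with classes had the same size i,
-- then r * (i - 1) = c - 1 with i ≥ 2, so r and c are coprime and r < c.  From
-- v = d * c we get r * (k - i) = c * (d - 1) > 0, so c divides k - i, against
-- k - i < k ≤ r < c.
-- (ii) If c is in the spectrum, every line contains a whole class; a class lies
-- in at most one line, so there are at most d < v lines, against v ≤ b.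
-- (iii) By line-transitivity every line has the same spectrum {1, h}, so a line
-- meeting a class in at least two points meets it in h.

module Submission where

open import Defs
open import Data.Fin.Subset using (⊤; ∣_∣)
open import Data.List using ([]; _∷_; length)
open import Data.List.Membership.Propositional using (_∈_; _∉_)
open import Data.List.Relation.Binary.BagAndSetEquality using (_∼[_]_; set)
open import Data.Nat using (ℕ; _≤_; _<_)
open import Data.Product using (_×_)
open import Relation.Binary.PropositionalEquality using (_≡_)

open import Data.Bool using (true; false)
open import Data.Fin using (Fin; zero; suc)
open import Data.Fin.Permutation using (Permutation′; _⟨$⟩ʳ_; _⟨$⟩ˡ_; inverseˡ; inverseʳ)
import Data.Fin.Properties as Fin
open import Data.Fin.Subset
  using (Subset; inside; outside; _⊆_; _∩_; _-_; Nonempty)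
  renaming (_∈_ to _∈ˢ_; _∉_ to _∉ˢ_)
open import Data.Fin.Subset.Properties
  using (_∈?_; _⊆?_; ∈⊤; ∣⊤∣≡n; ∣∁p∣≡n∸∣p∣; x∈∁p⇒x∉p; p∩q⊆p; p∩q⊆q; x∈p∩q⁺; x∈p∩q⁻;
         p─⊥≡p; p─q⊆p; x∈p∧x≢y⇒x∈p-y; p⊂q⇒∣p∣<∣q∣; ∣p∩q∣≤∣q∣; ∣p∣≤n;
         Empty-unique; nonempty?; ∣⊥∣≡0; ∩-comm; ⊆-antisym; ∩-identityˡ)
open import Data.List using (List; filter; map; upTo)
open import Data.List.Membership.Propositional.Properties
  using (∈-map⁺; ∈-map⁻; ∈-filter⁺; ∈-filter⁻; ∈-deduplicate⁻; ∈-length; ∈-upTo⁺)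
open import Data.List.Properties using (length-map)
open import Data.List.Relation.Unary.All using ([]; _∷_)
import Data.List.Relation.Unary.All as All
open import Data.List.Relation.Unary.AllPairs using ([]; _∷_)
open import Data.List.Relation.Unary.Any using (here; there)
open import Data.List.Relation.Unary.Unique.Propositional using (Unique)
import Data.List.Relation.Unary.Unique.Propositional.Properties as Unique
open import Data.Nat
  using (zero; suc; _+_; _*_; z≤n; s≤s; s≤s⁻¹; _≤?_; _<?_; _≟_; >-nonZero)
open import Data.Nat.Coprimality using (Coprime; coprime-divisor)
open import Data.Nat.Divisibility using (_∣_; divides; ∣m+n∣m⇒∣n; ∣m⇒∣m*n; ∣1⇒≡1; ∣⇒≤)
open import Data.Nat.ListAction using (sum)
open import Data.Nat.Properties
  using (≤-refl; ≤-reflexive; ≤-trans; ≤-antisym; <-irrefl; <⇒≤; <⇒≢; >⇒≢; ≮⇒≥; n<1+n;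
         suc-injective; +-comm; +-cancelˡ-≡; +-mono-≤; m≤n+m; m<n⇒0<n∸m; m≤n⇒∃[o]m+o≡n; n≢0⇒n>0;
         *-identityʳ; *-zeroʳ; *-distribˡ-+; *-cancelʳ-≡; *-cancelʳ-≤; m≤m*n; m<m*n;
         module ≤-Reasoning)
open import Data.Nat.Tactic.RingSolver using (solve-∀)
open import Data.Product using (∃; _,_; proj₁; proj₂)
open import Data.Vec using ([]; _∷_; lookup; here; there)
open import Data.Vec.Properties using (lookup∘tabulate; []=⇒lookup; lookup⇒[]=)
open import Function using (_∘_; Equivalence)
open import Level using (Level)
open import Relation.Binary using (REL; DecidableEquality) renaming (Decidable to Decidable₂)
open import Relation.Binary.PropositionalEquality
  using (_≢_; refl; sym; trans; cong; subst; subst₂; module ≡-Reasoning)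
open import Relation.Nullary using (¬_; yes; no; contradiction; does)
open import Relation.Nullary.Decidable using (¬?; _×-dec_; decidable-stable)
open import Relation.Unary using (Pred; Decidable)

private
  variable
    a b p : Level
    A : Set a
    n v : ℕ

-- Double counting over finite lists

+-swap : ∀ l m n → l + (m + n) ≡ m + (l + n)
+-swap = solve-∀

module _ {P : Pred A p} (P? : Decidable P) where

  1≤length-filter : ∀ {x xs} → x ∈ xs → P x → 1 ≤ length (filter P? xs)
  1≤length-filter x∈ px = ∈-length (∈-filter⁺ P? x∈ px)

  length-filter≤1 : ∀ {xs} → Unique xs →
                    (∀ {x y} → x ∈ xs → y ∈ xs → P x → P y → x ≡ y) →
                    length (filter P? xs) ≤ 1
  length-filter≤1 []             _   = z≤n
  length-filter≤1 {x ∷ xs} (x≢ ∷ xs!) one with P? x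
  ... | no _   = length-filter≤1 xs! λ x∈ y∈ → one (there x∈) (there y∈)
  ... | yes px with filter P? xs in eq
  ...   | []    = ≤-refl
  ...   | y ∷ _ with y∈ , py ← ∈-filter⁻ P? {xs = xs} (subst (y ∈_) (sym eq) (here refl)) =
    contradiction (one (here refl) (there y∈) px py) (All.lookup x≢ y∈)

module _ (f : A → ℕ) {m : ℕ} where

  sum-map-≥ : ∀ xs → (∀ {x} → x ∈ xs → m ≤ f x) → length xs * m ≤ sum (map f xs)
  sum-map-≥ []       m≤ = z≤n
  sum-map-≥ (x ∷ xs) m≤ = +-mono-≤ (m≤ (here refl)) (sum-map-≥ xs (m≤ ∘ there))

  sum-map-≤ : ∀ xs → (∀ {x} → x ∈ xs → f x ≤ m) → sum (map f xs) ≤ length xs * m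
  sum-map-≤ []       ≤m = z≤n
  sum-map-≤ (x ∷ xs) ≤m = +-mono-≤ (≤m (here refl)) (sum-map-≤ xs (≤m ∘ there))

module _ {A : Set a} {B : Set b} {R : REL A B p} (R? : Decidable₂ R) where

  private
    row : List B → A → ℕ
    row ys x = length (filter (R? x) ys)

    column : List A → B → ℕ
    column xs y = length (filter (λ x → R? x y) xs)

  sum-column-[] : ∀ ys → sum (map (column []) ys) ≡ 0
  sum-column-[] []       = refl
  sum-column-[] (y ∷ ys) = sum-column-[] ys

  sum-column-∷ : ∀ x xs ys → sum (map (column (x ∷ xs)) ys) ≡ row ys x + sum (map (column xs) ys)
  sum-column-∷ x xs []       = refl
  -- Both filters branch on the same Boolean, so one case split decides whether the pair of `x` and
  -- `y` adds one to `column` and to `row`.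
  sum-column-∷ x xs (y ∷ ys) with ih ← sum-column-∷ x xs ys | does (R? x y)
  ... | true  = cong suc (trans (cong (column xs y +_) ih) (+-swap (column xs y) (row ys x) _))
  ... | false = trans (cong (column xs y +_) ih) (+-swap (column xs y) (row ys x) _)

  sum-row≡sum-column : ∀ xs ys → sum (map (row ys) xs) ≡ sum (map (column xs) ys)
  sum-row≡sum-column []       ys = sym (sum-column-[] ys)
  sum-row≡sum-column (x ∷ xs) ys =
    trans (cong (row ys x +_) (sum-row≡sum-column xs ys)) (sym (sum-column-∷ x xs ys))

  -- The number of related pairs is bounded below row by row and above column by column. Equalities
  -- are obtained later from two applications, the second with the relation transposed.
  double-counting-≤ : ∀ xs ys {s t} →
                      (∀ {x} → x ∈ xs → s ≤ length (filter (R? x) ys)) →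
                      (∀ {y} → y ∈ ys → length (filter (λ x → R? x y) xs) ≤ t) →
                      length xs * s ≤ length ys * t
  double-counting-≤ xs ys {s} {t} s≤ ≤t = begin
    length xs * s                ≤⟨ sum-map-≥ (row ys) xs s≤ ⟩
    sum (map (row ys) xs)        ≡⟨ sum-row≡sum-column xs ys ⟩
    sum (map (column xs) ys)     ≤⟨ sum-map-≤ (column xs) ys ≤t ⟩
    length ys * t                ∎
    where open ≤-Reasoning

-- Double counting for the relation of equality: each entry of `xs` has a partner in `ys`, and since
-- `xs` has no repetition, no entry of `ys` is a partner twice.
length-mono-⊆ : DecidableEquality A → ∀ {xs ys : List A} → Unique xs →
                (∀ {x} → x ∈ xs → x ∈ ys) → length xs ≤ length ys
length-mono-⊆ _≟_ {xs} {ys} xs! xs⊆ys = begin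
  length xs      ≡⟨ *-identityʳ _ ⟨
  length xs * 1  ≤⟨ double-counting-≤ _≟_ xs ys
                      (λ x∈ → 1≤length-filter _ (xs⊆ys x∈) refl)
                      (λ _ → length-filter≤1 _ xs! λ _ _ x≡z y≡z → trans x≡z (sym y≡z)) ⟩
  length ys * 1  ≡⟨ *-identityʳ _ ⟩
  length ys      ∎
  where open ≤-Reasoning

-- Subsets as lists, and their cardinalities

elements : Subset n → List (Fin n)
elements []            = []
elements (inside  ∷ p) = zero ∷ map suc (elements p)
elements (outside ∷ p) = map suc (elements p)

length-elements : (p : Subset n) → length (elements p) ≡ ∣ p ∣
length-elements []            = refl
length-elements (inside  ∷ p) = cong suc (trans (length-map suc (elements p)) (length-elements p))
length-elements (outside ∷ p) = trans (length-map suc (elements p)) (length-elements p)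

∈-elements⁺ : ∀ {p : Subset n} {x} → x ∈ˢ p → x ∈ elements p
∈-elements⁺ {p = inside  ∷ p} here       = here refl
∈-elements⁺ {p = inside  ∷ p} (there x∈) = there (∈-map⁺ suc (∈-elements⁺ x∈))
∈-elements⁺ {p = outside ∷ p} (there x∈) = ∈-map⁺ suc (∈-elements⁺ x∈)

∈-elements⁻ : ∀ {p : Subset n} {x} → x ∈ elements p → x ∈ˢ p
∈-elements⁻ {p = inside  ∷ p} (here refl) = here
∈-elements⁻ {p = inside  ∷ p} (there x∈) with _ , y∈ , refl ← ∈-map⁻ suc x∈ =
  there (∈-elements⁻ y∈)
∈-elements⁻ {p = outside ∷ p} x∈ with _ , y∈ , refl ← ∈-map⁻ suc x∈ = there (∈-elements⁻ y∈)

elements-unique : (p : Subset n) → Unique (elements p)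
elements-unique []            = []
elements-unique (inside  ∷ p) =
  All.tabulate (λ { x∈ refl → contradiction (∈-map⁻ suc x∈) λ { (_ , _ , ()) } })
  ∷ Unique.map⁺ Fin.suc-injective (elements-unique p)
elements-unique (outside ∷ p) = Unique.map⁺ Fin.suc-injective (elements-unique p)

-- Both sides count duplicate-free lists with the same members. This turns the columns of an
-- incidence relation into intersection sizes.
length-filter-elements : (p q : Subset n) → length (filter (_∈? q) (elements p)) ≡ ∣ p ∩ q ∣
length-filter-elements p q = trans
  (≤-antisym
    (length-mono-⊆ Fin._≟_ (Unique.filter⁺ (_∈? q) (elements-unique p)) λ x∈ →
      let x∈p , x∈q = ∈-filter⁻ (_∈? q) {xs = elements p} x∈ in
      ∈-elements⁺ {p = p ∩ q} (x∈p∩q⁺ (∈-elements⁻ x∈p , x∈q)))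
    (length-mono-⊆ Fin._≟_ (elements-unique (p ∩ q)) λ x∈ →
      let x∈p , x∈q = x∈p∩q⁻ p q (∈-elements⁻ x∈) in ∈-filter⁺ (_∈? q) (∈-elements⁺ x∈p) x∈q))
  (length-elements (p ∩ q))

∣p∣≡1+∣p-x∣ : ∀ {p : Subset n} {x} → x ∈ˢ p → ∣ p ∣ ≡ suc ∣ p - x ∣
∣p∣≡1+∣p-x∣ {p = inside  ∷ p} here       = cong (suc ∘ ∣_∣) (sym (p─⊥≡p p))
∣p∣≡1+∣p-x∣ {p = inside  ∷ p} (there x∈) = cong suc (∣p∣≡1+∣p-x∣ x∈)
∣p∣≡1+∣p-x∣ {p = outside ∷ p} (there x∈) = ∣p∣≡1+∣p-x∣ x∈

x∉p-x : ∀ (p : Subset n) x → x ∉ˢ p - x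
x∉p-x (_ ∷ p) zero    ()
x∉p-x (_ ∷ p) (suc x) (there x∈) = x∉p-x p x x∈

0<∣p∣⇒Nonempty : (p : Subset n) → 0 < ∣ p ∣ → Nonempty p
0<∣p∣⇒Nonempty {n} p 0<∣p∣ = decidable-stable (nonempty? p) λ empty →
  <⇒≢ 0<∣p∣ (sym (trans (cong ∣_∣ (Empty-unique {p = p} empty)) (∣⊥∣≡0 n)))

x∈p⇒0<∣p∣ : ∀ {p : Subset n} {x} → x ∈ˢ p → 0 < ∣ p ∣
x∈p⇒0<∣p∣ x∈p = subst (0 <_) (sym (∣p∣≡1+∣p-x∣ x∈p)) (s≤s z≤n)

two-distinct⁺ : ∀ {p : Subset n} {x y} → x ∈ˢ p → y ∈ˢ p → x ≢ y → 1 < ∣ p ∣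
two-distinct⁺ x∈p y∈p x≢y =
  subst (1 <_) (sym (∣p∣≡1+∣p-x∣ x∈p)) (s≤s (x∈p⇒0<∣p∣ (x∈p∧x≢y⇒x∈p-y y∈p (x≢y ∘ sym))))

another : ∀ {p : Subset n} {x} → 1 < ∣ p ∣ → x ∈ˢ p → ∃ λ y → y ∈ˢ p × x ≢ y
another {p = p} {x} 1<∣p∣ x∈p
  with y , y∈ ← 0<∣p∣⇒Nonempty _ (s≤s⁻¹ (subst (1 <_) (∣p∣≡1+∣p-x∣ x∈p) 1<∣p∣)) =
  y , p─q⊆p p _ y∈ , λ { refl → x∉p-x p x y∈ }

two-distinct⁻ : ∀ {p : Subset n} → 1 < ∣ p ∣ → ∃ λ x → ∃ λ y → x ∈ˢ p × y ∈ˢ p × x ≢ y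
two-distinct⁻ 1<∣p∣ =
  let x , x∈p       = 0<∣p∣⇒Nonempty _ (<⇒≤ 1<∣p∣)
      y , y∈p , x≢y = another 1<∣p∣ x∈p
  in x , y , x∈p , y∈p , x≢y

∣p∣<n⇒∃∉ : {p : Subset n} → ∣ p ∣ < n → ∃ λ x → x ∉ˢ p
∣p∣<n⇒∃∉ {p = p} ∣p∣<n
  with x , x∈ ← 0<∣p∣⇒Nonempty _ (subst (0 <_) (sym (∣∁p∣≡n∸∣p∣ p)) (m<n⇒0<n∸m ∣p∣<n)) =
  x , x∈∁p⇒x∉p x∈

-- A point of `p` outside `q` would make `p ∩ q` a proper subset of `p`. Used to read an
-- intersection of size `c` as a class contained in a line.
∣p∩q∣≡∣p∣⇒p⊆q : (p q : Subset n) → ∣ p ∩ q ∣ ≡ ∣ p ∣ → p ⊆ q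
∣p∩q∣≡∣p∣⇒p⊆q p q eq {x} x∈p = decidable-stable (x ∈? q) λ x∉q →
  <⇒≢ (p⊂q⇒∣p∣<∣q∣ (p∩q⊆p p q , x , x∈p , x∉q ∘ p∩q⊆q p q)) eq

-- Images of subsets under permutations

x∈image⁺ : ∀ (g : Permutation′ n) {p y} → g ⟨$⟩ˡ y ∈ˢ p → y ∈ˢ image g p
x∈image⁺ g {p} {y} gy∈p =
  lookup⇒[]= y _ (trans (lookup∘tabulate _ y) ([]=⇒lookup gy∈p))

x∈image⁻ : ∀ (g : Permutation′ n) p {y} → y ∈ˢ image g p → g ⟨$⟩ˡ y ∈ˢ p
x∈image⁻ g p {y} y∈ =
  lookup⇒[]= _ p (trans (sym (lookup∘tabulate _ y)) ([]=⇒lookup y∈))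

-- One inequality for each direction of the bijection: `g ⟨$⟩ˡ_` maps `image g p` injectively into
-- `p`, and `g ⟨$⟩ʳ_` maps `p` injectively into `image g p`.
∣image∣ : ∀ (g : Permutation′ n) p → ∣ image g p ∣ ≡ ∣ p ∣
∣image∣ g p = trans (sym (length-elements (image g p))) (trans
  (≤-antisym
    (≤-trans (≤-reflexive (sym (length-map (g ⟨$⟩ˡ_) (elements (image g p)))))
      (length-mono-⊆ Fin._≟_ (Unique.map⁺ ˡ-injective (elements-unique (image g p))) λ x∈ →
        let y , y∈ , x≡ = ∈-map⁻ (g ⟨$⟩ˡ_) x∈ in
        ∈-elements⁺ (subst (_∈ˢ p) (sym x≡) (x∈image⁻ g p (∈-elements⁻ y∈)))))
    (≤-trans (≤-reflexive (sym (length-map (g ⟨$⟩ʳ_) (elements p))))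
      (length-mono-⊆ Fin._≟_ (Unique.map⁺ ʳ-injective (elements-unique p)) λ x∈ →
        let y , y∈ , x≡ = ∈-map⁻ (g ⟨$⟩ʳ_) x∈ in
        ∈-elements⁺ (x∈image⁺ g
          (subst (_∈ˢ p) (sym (trans (cong (g ⟨$⟩ˡ_) x≡) (inverseˡ g))) (∈-elements⁻ y∈))))))
  (length-elements p))
  where
  ˡ-injective : ∀ {x y} → g ⟨$⟩ˡ x ≡ g ⟨$⟩ˡ y → x ≡ y
  ˡ-injective eq = trans (sym (inverseʳ g)) (trans (cong (g ⟨$⟩ʳ_) eq) (inverseʳ g))

  ʳ-injective : ∀ {x y} → g ⟨$⟩ʳ x ≡ g ⟨$⟩ʳ y → x ≡ y
  ʳ-injective eq = trans (sym (inverseˡ g)) (trans (cong (g ⟨$⟩ˡ_) eq) (inverseˡ g))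

image-∩ : ∀ (g : Permutation′ n) p q → image g (p ∩ q) ≡ image g p ∩ image g q
image-∩ g p q = ⊆-antisym
  (λ x∈ → let x∈p , x∈q = x∈p∩q⁻ p q (x∈image⁻ g (p ∩ q) x∈) in x∈p∩q⁺ (x∈image⁺ g x∈p , x∈image⁺ g x∈q))
  (λ x∈ → let x∈p , x∈q = x∈p∩q⁻ (image g p) (image g q) x∈ in
          x∈image⁺ g (x∈p∩q⁺ (x∈image⁻ g p x∈p , x∈image⁻ g q x∈q)))

[p-x]∩q≡[p∩q]-x : ∀ (p q : Subset n) x → (p - x) ∩ q ≡ (p ∩ q) - x
[p-x]∩q≡[p∩q]-x (_ ∷ p) (_ ∷ q) zero    =
  cong (outside ∷_) (trans (cong (_∩ q) (p─⊥≡p p)) (sym (p─⊥≡p (p ∩ q))))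
[p-x]∩q≡[p∩q]-x (_ ∷ p) (_ ∷ q) (suc x) = cong (_ ∷_) ([p-x]∩q≡[p∩q]-x p q x)

-- Counting lines through a point of a linear space

module _ (S : LinearSpace (⊤ {v})) where

  pencil : Fin v → List (Subset v)
  pencil x = filter (x ∈?_) (lines S)

  joining-line : ∀ {x y} → x ≢ y → ∃ λ ℓ → ℓ ∈ lines S × x ∈ˢ ℓ × y ∈ˢ ℓ
  joining-line x≢y with ℓ , ℓ∋x,y , _ ← join S ∈⊤ ∈⊤ x≢y = ℓ , ℓ∋x,y

  line-unique : ∀ {x y ℓ m} → x ≢ y → ℓ ∈ lines S → x ∈ˢ ℓ → y ∈ˢ ℓ →
                m ∈ lines S → x ∈ˢ m → y ∈ˢ m → ℓ ≡ m
  line-unique x≢y ℓ∈ x∈ℓ y∈ℓ m∈ x∈m y∈m with _ , _ , unique ← join S ∈⊤ ∈⊤ x≢y =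
    trans (sym (unique (ℓ∈ , x∈ℓ , y∈ℓ))) (unique (m∈ , x∈m , y∈m))

  pencil-unique : ∀ x → Unique (pencil x)
  pencil-unique x = Unique.filter⁺ (x ∈?_) (lines-unique S)

  1≤length-join : ∀ {x y} → x ≢ y → 1 ≤ length (filter (y ∈?_) (pencil x))
  1≤length-join {x} {y} x≢y with ℓ , ℓ∈ , x∈ℓ , y∈ℓ ← joining-line x≢y =
    1≤length-filter (y ∈?_) (∈-filter⁺ (x ∈?_) ℓ∈ x∈ℓ) y∈ℓ

  length-join≤1 : ∀ {x y} → x ≢ y → length (filter (y ∈?_) (pencil x)) ≤ 1
  length-join≤1 {x} {y} x≢y = length-filter≤1 (y ∈?_) (pencil-unique x) λ ℓ∈ m∈ y∈ℓ y∈m →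
    let ℓ∈ , x∈ℓ = ∈-filter⁻ (x ∈?_) {xs = lines S} ℓ∈
        m∈ , x∈m = ∈-filter⁻ (x ∈?_) {xs = lines S} m∈
    in line-unique x≢y ℓ∈ x∈ℓ y∈ℓ m∈ x∈m y∈m

  -- Count pairs of a point of `F - x` and a line through it and `x`: each such point is on exactly
  -- one line of the pencil, and each line of the pencil carries `j` such points. Taking for `F` the
  -- whole space relates r to v and k; taking a class relates r to c and i.
  ∣F∣≡1+r*j : ∀ {F x j} → x ∈ˢ F →
              (∀ {m} → m ∈ lines S → x ∈ˢ m → ∣ F ∩ m ∣ ≡ suc j) →
              ∣ F ∣ ≡ suc (length (pencil x) * j)
  ∣F∣≡1+r*j {F} {x} {j} x∈F ∣F∩m∣≡ = trans (∣p∣≡1+∣p-x∣ x∈F) (cong suc (begin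
    ∣ F - x ∣              ≡⟨ length-elements (F - x) ⟨
    length others          ≡⟨ *-identityʳ _ ⟨
    length others * 1      ≡⟨ ≤-antisym
      (double-counting-≤ _∈?_ others (pencil x)
        (1≤length-join ∘ x≢) (≤-reflexive ∘ column))
      (double-counting-≤ (λ m y → y ∈? m) (pencil x) others
        (≤-reflexive ∘ sym ∘ column) (length-join≤1 ∘ x≢)) ⟩
    length (pencil x) * j  ∎))
    where
    open ≡-Reasoning

    others : List (Fin v)
    others = elements (F - x)

    x≢ : ∀ {y} → y ∈ others → x ≢ y
    x≢ y∈ refl = x∉p-x F x (∈-elements⁻ y∈)

    column : ∀ {m} → m ∈ pencil x → length (filter (_∈? m) others) ≡ j
    column {m} m∈ with m∈ , x∈m ← ∈-filter⁻ (x ∈?_) {xs = lines S} m∈ = suc-injective (begin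
      suc (length (filter (_∈? m) others))  ≡⟨ cong suc (length-filter-elements (F - x) m) ⟩
      suc ∣ (F - x) ∩ m ∣                   ≡⟨ cong (suc ∘ ∣_∣) ([p-x]∩q≡[p∩q]-x F m x) ⟩
      suc ∣ (F ∩ m) - x ∣                   ≡⟨ ∣p∣≡1+∣p-x∣ (x∈p∩q⁺ (x∈F , x∈m)) ⟨
      ∣ F ∩ m ∣                             ≡⟨ ∣F∩m∣≡ m∈ x∈m ⟩
      suc j                                 ∎)

  ∣line∣≤length-pencil : ∀ {ℓ x} → ℓ ∈ lines S → x ∉ˢ ℓ → ∣ ℓ ∣ ≤ length (pencil x)
  ∣line∣≤length-pencil {ℓ} {x} ℓ∈ x∉ℓ = begin
    ∣ ℓ ∣                   ≡⟨ length-elements ℓ ⟨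
    length (elements ℓ)     ≡⟨ *-identityʳ _ ⟨
    length (elements ℓ) * 1 ≤⟨ double-counting-≤ _∈?_ (elements ℓ) (pencil x)
      (λ y∈ → 1≤length-join λ { refl → x∉ℓ (∈-elements⁻ y∈) }) column ⟩
    length (pencil x) * 1   ≡⟨ *-identityʳ _ ⟩
    length (pencil x)       ∎
    where
    open ≤-Reasoning

    column : ∀ {m} → m ∈ pencil x → length (filter (_∈? m) (elements ℓ)) ≤ 1
    column {m} m∈ with m∈ , x∈m ← ∈-filter⁻ (x ∈?_) {xs = lines S} m∈ =
      -- If `m` shared two points with `ℓ`, the two lines would coincide and `ℓ` would contain `x`.
      length-filter≤1 (_∈? m) (elements-unique ℓ) λ {y} {z} y∈ z∈ y∈m z∈m →
        decidable-stable (y Fin.≟ z) λ y≢z → x∉ℓ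
          (subst (x ∈ˢ_) (sym (line-unique y≢z ℓ∈ (∈-elements⁻ y∈) (∈-elements⁻ z∈) m∈ y∈m z∈m)) x∈m)

  module _ {k : ℕ} (∣line∣ : ConstantLineSize S k) where

    v≡1+r*[k-1] : ∀ {j} → k ≡ suc j → ∀ x → v ≡ suc (length (pencil x) * j)
    v≡1+r*[k-1] k≡ x = trans (sym (∣⊤∣≡n v))
      (∣F∣≡1+r*j ∈⊤ λ {m} m∈ _ → trans (cong ∣_∣ (∩-identityˡ m)) (trans (∣line∣ m∈) k≡))

    -- The bound by a pencil holds directly only at a point `y` off `ℓ`, which exists because k < v.
    -- The equation v - 1 = r * (k - 1) holds at every point, and cancelling the nonzero k - 1 shows
    -- that the pencils at `y` and `x` have the same size.
    k≤r : 1 < k → k < v → ∀ {ℓ} → ℓ ∈ lines S → ∀ x → k ≤ length (pencil x)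
    k≤r 1<k@(s≤s (s≤s z≤n)) k<v {ℓ} ℓ∈ x
      with y , y∉ℓ ← ∣p∣<n⇒∃∉ (subst (_< v) (sym (∣line∣ ℓ∈)) k<v) =
      subst (k ≤_)
        (*-cancelʳ-≡ _ _ _ (suc-injective (trans (sym (v≡1+r*[k-1] refl y)) (v≡1+r*[k-1] refl x))))
        (subst (_≤ _) (∣line∣ ℓ∈) (∣line∣≤length-pencil ℓ∈ y∉ℓ))

    -- Fisher's inequality, by counting flags.
    v≤b : 1 < k → k < v → ∀ {ℓ} → ℓ ∈ lines S → v ≤ length (lines S)
    v≤b 1<k@(s≤s (s≤s z≤n)) k<v ℓ∈ = *-cancelʳ-≤ v (length (lines S)) k (begin
      v * k                           ≡⟨ cong (_* k) (∣⊤∣≡n v) ⟨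
      ∣ ⊤ {v} ∣ * k                   ≡⟨ cong (_* k) (length-elements (⊤ {v})) ⟨
      length (elements (⊤ {v})) * k   ≤⟨ double-counting-≤ _∈?_ (elements (⊤ {v})) (lines S)
        (λ {x} _ → k≤r 1<k k<v ℓ∈ x)
        (λ {m} m∈ → ≤-reflexive (trans (length-filter-elements ⊤ m)
          (trans (cong ∣_∣ (∩-identityˡ m)) (∣line∣ m∈)))) ⟩
      length (lines S) * k            ∎)
      where open ≤-Reasoning

-- Partitions, spectra and their invariance

module _ (𝔠 : Partition v) where

  class-of : ∀ x → ∃ λ C → C ∈ classes 𝔠 × x ∈ˢ C
  class-of x with C , C∋x , _ ← classOf 𝔠 x = C , C∋x

  v≡d*c : ∀ {c} → (∀ {C} → C ∈ classes 𝔠 → ∣ C ∣ ≡ c) → v ≡ length (classes 𝔠) * c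
  v≡d*c {c} ∣class∣ = begin
    v                          ≡⟨ ∣⊤∣≡n v ⟨
    ∣ ⊤ {v} ∣                  ≡⟨ length-elements (⊤ {v}) ⟨
    length points              ≡⟨ *-identityʳ _ ⟨
    length points * 1          ≡⟨ ≤-antisym
      (double-counting-≤ _∈?_ points (classes 𝔠) (λ {x} _ → 1≤ x) (≤-reflexive ∘ column))
      (double-counting-≤ (λ C x → x ∈? C) (classes 𝔠) points
        (≤-reflexive ∘ sym ∘ column) (λ {x} _ → ≤1 x)) ⟩
    length (classes 𝔠) * c     ∎
    where
    open ≡-Reasoning

    points : List (Fin v)
    points = elements ⊤

    column : ∀ {C} → C ∈ classes 𝔠 → length (filter (_∈? C) points) ≡ c
    column {C} C∈ =
      trans (length-filter-elements ⊤ C) (trans (cong ∣_∣ (∩-identityˡ C)) (∣class∣ C∈))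

    1≤ : ∀ x → 1 ≤ length (filter (x ∈?_) (classes 𝔠))
    1≤ x with _ , C∈ , x∈C ← class-of x = 1≤length-filter (x ∈?_) C∈ x∈C

    ≤1 : ∀ x → length (filter (x ∈?_) (classes 𝔠)) ≤ 1
    ≤1 x = length-filter≤1 (x ∈?_) (classes-unique 𝔠) λ C∈ D∈ x∈C x∈D →
      let _ , _ , unique = classOf 𝔠 x in trans (sym (unique (C∈ , x∈C))) (unique (D∈ , x∈D))

  spec⁺ : ∀ {C ℓ i} → C ∈ classes 𝔠 → 0 < i → ∣ C ∩ ℓ ∣ ≡ i → i ∈ spec 𝔠 ℓ
  spec⁺ {C} {ℓ} {i} C∈ 0<i refl =
    ∈-filter⁺ (λ i → (0 <? i) ×-dec ¬? (classesMeeting 𝔠 ℓ i ≟ 0)) (∈-upTo⁺ (s≤s (∣p∣≤n (C ∩ ℓ))))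
      (0<i , >⇒≢ (1≤length-filter (λ C → ∣ C ∩ ℓ ∣ ≟ i) C∈ refl))

  spec⁻ : ∀ {ℓ i} → i ∈ spec 𝔠 ℓ → 0 < i × ∃ λ C → C ∈ classes 𝔠 × ∣ C ∩ ℓ ∣ ≡ i
  spec⁻ {ℓ} {i} i∈
    with _ , 0<i , dᵢ≢0 ← ∈-filter⁻ (λ i → (0 <? i) ×-dec ¬? (classesMeeting 𝔠 ℓ i ≟ 0))
                            {xs = upTo (suc v)} i∈
    with filter (λ C → ∣ C ∩ ℓ ∣ ≟ i) (classes 𝔠) in eq
  ... | []    = contradiction refl dᵢ≢0
  ... | C ∷ _ = 0<i , C , ∈-filter⁻ (λ C → ∣ C ∩ ℓ ∣ ≟ i) (subst (C ∈_) (sym eq) (here refl))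

-- A group element taking `ℓ` to `m` takes a class `C` to a class and `C ∩ ℓ` to the intersection of
-- that class with `m`, preserving its size.
spec-⊆ : ∀ {S : LinearSpace (⊤ {v})} (G : AutSubgroup S) → LineTransitive G →
         ∀ (𝔠 : Partition v) → Invariant G 𝔠 → ∀ {ℓ m i} → ℓ ∈ lines S → m ∈ lines S →
         i ∈ spec 𝔠 ℓ → i ∈ spec 𝔠 m
spec-⊆ G transitive 𝔠 invariant {ℓ} ℓ∈ m∈ i∈
  with g , g∈G , refl ← transitive ℓ∈ m∈
     | 0<i , C , C∈ , ∣C∩ℓ∣≡i ← spec⁻ 𝔠 i∈ =
  spec⁺ 𝔠 (invariant g∈G C∈) 0<i
    (trans (cong ∣_∣ (sym (image-∩ g C ℓ))) (trans (∣image∣ g (C ∩ ℓ)) ∣C∩ℓ∣≡i))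

-- Contradictions from uniform intersections and from lines containing classes

-- The parameters of a space with spectrum {i}, where i = 1 + j and k = 1 + j + l.
no-uniform-intersection : ∀ {r j l c d} → 1 < d → 0 < j → suc (j + l) ≤ r → c ≡ suc (r * j) →
                          ¬ d * c ≡ suc (r * (j + l))
no-uniform-intersection {r} {j} {l} {c} {suc (suc d)} (s≤s _) 0<j k≤r refl dc≡ =
  <-irrefl refl (begin-strict
    c          ≤⟨ ∣⇒≤ {{>-nonZero 0<l}} (coprime-divisor coprime (divides (suc d) rl≡)) ⟩
    l          ≤⟨ m≤n+m l j ⟩
    j + l      <⟨ k≤r ⟩
    r          ≤⟨ m≤m*n r j {{>-nonZero 0<j}} ⟩
    r * j      <⟨ n<1+n _ ⟩
    c          ∎)
  where
  open ≤-Reasoning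

  -- After the match `suc d` is the number of classes minus one. Removing one summand `c`, which is
  -- 1 + r * j, from both sides of `dc≡` leaves this.
  rl≡ : r * l ≡ suc d * c
  rl≡ = +-cancelˡ-≡ c _ _ (trans (cong suc (sym (*-distribˡ-+ r j l))) (sym dc≡))

  -- Geometrically, `l` = 0 would put every line inside one class. Numerically, `suc d * c` would
  -- vanish although `c` is a successor.
  0<l : 0 < l
  0<l = n≢0⇒n>0 λ { refl → contradiction (trans (sym (*-zeroʳ r)) rl≡) λ () }

  coprime : Coprime c r
  coprime {e} (e∣c , e∣r) = ∣1⇒≡1 (∣m+n∣m⇒∣n (subst (e ∣_) (+-comm 1 (r * j)) e∣c) (∣m⇒∣m*n j e∣r))

module _ (S : LinearSpace (⊤ {v})) {k c : ℕ} (2<k : 2 < k) (k<v : k < v)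
         (∣line∣ : ConstantLineSize S k) (𝔠 : Partition v) (nontrivial : NonTrivial 𝔠)
         (∣class∣ : ∀ {C} → C ∈ classes 𝔠 → ∣ C ∣ ≡ c) where

  private
    1<k : 1 < k
    1<k = <⇒≤ 2<k

  spectrum-not-singleton : ∀ {ℓ i} → ℓ ∈ lines S →
    ¬ (∀ {m C x} → m ∈ lines S → C ∈ classes 𝔠 → x ∈ˢ C → x ∈ˢ m → ∣ C ∩ m ∣ ≡ i)
  spectrum-not-singleton {ℓ} {i} ℓ∈ uniform
    with x , x∈ℓ ← 0<∣p∣⇒Nonempty ℓ (<⇒≤ (2≤∣line∣ S ℓ∈))
    with C , C∈ , x∈C ← class-of 𝔠 x
    with y , y∈C , x≢y ← another (proj₂ nontrivial C∈) x∈C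
    with m , m∈ , x∈m , y∈m ← joining-line S x≢y
    -- The joining line `m` has two points in `C`, so `i` is at least 2. It becomes `suc (suc j)`,
    -- and the positive number i - 1 is `suc j`.
    with s≤s {n = suc j} (s≤s z≤n) ← subst (1 <_) (uniform m∈ C∈ x∈C x∈m)
           (two-distinct⁺ (x∈p∩q⁺ (x∈C , x∈m)) (x∈p∩q⁺ (y∈C , y∈m)) x≢y)
    -- Here `l` is k - i, available because `C ∩ ℓ` has `i` points and lies in `ℓ`.
    with l , k≡ ← m≤n⇒∃[o]m+o≡n (subst₂ _≤_ (uniform ℓ∈ C∈ x∈C x∈ℓ) (∣line∣ ℓ∈) (∣p∩q∣≤∣q∣ C ℓ))
    = no-uniform-intersection (proj₁ nontrivial) (s≤s z≤n)
        (subst (_≤ _) (sym k≡) (k≤r S ∣line∣ 1<k k<v ℓ∈ x))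
        (trans (sym (∣class∣ C∈)) (∣F∣≡1+r*j S x∈C λ m∈ x∈m → uniform m∈ C∈ x∈C x∈m))
        (trans (sym (v≡d*c 𝔠 ∣class∣)) (v≡1+r*[k-1] S ∣line∣ (sym k≡) x))

  ¬lines-contain-classes : ∀ {ℓ} → ℓ ∈ lines S →
    ¬ (∀ {m} → m ∈ lines S → ∃ λ C → C ∈ classes 𝔠 × C ⊆ m)
  ¬lines-contain-classes {ℓ} ℓ∈ contained = <-irrefl refl (begin-strict
    d                      <⟨ m<m*n d c {{>-nonZero (<⇒≤ (proj₁ nontrivial))}} 1<c ⟩
    d * c                  ≡⟨ v≡d*c 𝔠 ∣class∣ ⟨
    v                      ≤⟨ v≤b S ∣line∣ 1<k k<v ℓ∈ ⟩
    length (lines S)       ≡⟨ *-identityʳ _ ⟨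
    length (lines S) * 1   ≤⟨ double-counting-≤ (λ m C → C ⊆? m) (lines S) (classes 𝔠)
      (λ m∈ → let C , C∈ , C⊆m = contained m∈ in 1≤length-filter (_⊆? _) C∈ C⊆m)
      -- Two distinct points of a class already determine any line containing it.
      (λ C∈ → length-filter≤1 (_ ⊆?_) (lines-unique S) λ m∈ m′∈ C⊆m C⊆m′ →
        let x , y , x∈C , y∈C , x≢y = two-distinct⁻ (proj₂ nontrivial C∈) in
        line-unique S x≢y m∈ (C⊆m x∈C) (C⊆m y∈C) m′∈ (C⊆m′ x∈C) (C⊆m′ y∈C)) ⟩
    d * 1                  ≡⟨ *-identityʳ _ ⟩
    d                      ∎)
    where
    open ≤-Reasoning

    d : ℕ
    d = length (classes 𝔠)

    1<c : 1 < c
    1<c = let C , C∈ , _ = contained ℓ∈ in subst (1 <_) (∣class∣ C∈) (proj₂ nontrivial C∈)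

-- The three assertions about the spectrum

length≤1⇒≡ : ∀ (xs : List A) → length xs ≤ 1 → ∀ {x y} → x ∈ xs → y ∈ xs → x ≡ y
length≤1⇒≡ (_ ∷ []) _ (here refl) (here refl) = refl
length≤1⇒≡ (_ ∷ _ ∷ _) (s≤s ())

theorem4p2 : ∀ (v k d c : ℕ) → 2 < k → k < v →
    ∀ (S : LinearSpace (⊤ {v})) → ConstantLineSize S k →
    ∀ (G : AutSubgroup S) → LineTransitive G →
    ∀ (𝔠 : Partition v) → NonTrivial 𝔠 → Invariant G 𝔠 →
    length (classes 𝔠) ≡ d → (∀ {C} → C ∈ classes 𝔠 → ∣ C ∣ ≡ c) →
    ∀ {ℓ} → ℓ ∈ lines S →
    2 ≤ length (spec 𝔠 ℓ)
    × c ∉ spec 𝔠 ℓ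
    × (∀ h → 2 ≤ h → spec 𝔠 ℓ ∼[ set ] (1 ∷ h ∷ []) →
    ∀ {C} → C ∈ classes 𝔠 → ConstantLineSize (induced S C) h)
theorem4p2 v k d c 2<k k<v S ∣line∣ G transitive 𝔠 nontrivial invariant _ ∣class∣ {ℓ} ℓ∈ =
  ≮⇒≥ two-sizes , no-full-class , induced-size
  where
  -- The common point makes the intersection size positive, hence a member of the spectrum of `m`;
  -- line-transitivity moves it to the fixed line `ℓ`.
  ∈-spec : ∀ {m C x} → m ∈ lines S → C ∈ classes 𝔠 → x ∈ˢ C → x ∈ˢ m → ∣ C ∩ m ∣ ∈ spec 𝔠 ℓ
  ∈-spec m∈ C∈ x∈C x∈m = spec-⊆ G transitive 𝔠 invariant m∈ ℓ∈
    (spec⁺ 𝔠 C∈ (x∈p⇒0<∣p∣ (x∈p∩q⁺ (x∈C , x∈m))) refl)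

  two-sizes : ¬ length (spec 𝔠 ℓ) < 2
  two-sizes (s≤s ≤1)
    -- The class of any point of `ℓ` supplies the reference size `∣ C ∩ ℓ ∣`, which every other
    -- intersection size must equal.
    with x , x∈ℓ ← 0<∣p∣⇒Nonempty ℓ (<⇒≤ (2≤∣line∣ S ℓ∈))
    with C , C∈ , x∈C ← class-of 𝔠 x =
    spectrum-not-singleton S 2<k k<v ∣line∣ 𝔠 nontrivial ∣class∣ ℓ∈ λ m∈ D∈ y∈D y∈m →
      length≤1⇒≡ _ ≤1 (∈-spec m∈ D∈ y∈D y∈m) (∈-spec ℓ∈ C∈ x∈C x∈ℓ)

  no-full-class : c ∉ spec 𝔠 ℓ
  no-full-class c∈ = ¬lines-contain-classes S 2<k k<v ∣line∣ 𝔠 nontrivial ∣class∣ ℓ∈ λ {m} m∈ →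
    let _ , C , C∈ , ∣C∩m∣≡c = spec⁻ 𝔠 (spec-⊆ G transitive 𝔠 invariant ℓ∈ m∈ c∈) in
    C , C∈ , ∣p∩q∣≡∣p∣⇒p⊆q C m (trans ∣C∩m∣≡c (sym (∣class∣ C∈)))

  induced-size : ∀ h → 2 ≤ h → spec 𝔠 ℓ ∼[ set ] (1 ∷ h ∷ []) →
                 ∀ {C} → C ∈ classes 𝔠 → ConstantLineSize (induced S C) h
  induced-size h 2≤h spec∼ {C} C∈ {μ} μ∈
    with μ∈ , 2≤∣μ∣ ← ∈-filter⁻ (λ μ → 2 ≤? ∣ μ ∣) {xs = map (_∩ C) (lines S)}
                        (∈-deduplicate⁻ _≟ˢ_ _ μ∈)
    with m , m∈ , refl ← ∈-map⁻ (_∩ C) μ∈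
    with x , x∈ ← 0<∣p∣⇒Nonempty (m ∩ C) (<⇒≤ 2≤∣μ∣)
    with x∈m , x∈C ← x∈p∩q⁻ m C x∈
    with Equivalence.to spec∼ (∈-spec m∈ C∈ x∈C x∈m)
  -- The value 1 is excluded because an induced line has at least two points.
  ... | here ≡1         = contradiction (trans (cong ∣_∣ (∩-comm m C)) ≡1) (>⇒≢ 2≤∣μ∣)
  ... | there (here ≡h) = trans (cong ∣_∣ (∩-comm m C)) ≡h
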